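{- There exists a finite structure (with finite signature) that has bounded relational width but does not have relational width $(2,3)$.
   Context: Structures may contain operations and relations; homomorphisms commute with operations and preserve relations. $\mathrm{graph}(\mathcal A)$ is the relational structure on the same domain with the relations of $\mathcal A$ plus, for each $k$-ary operation $f$, the relation $\{(a_1,\dots,a_k,f(a_1,\dots,a_k))\}$. Let $X,A$ be sets and $k$ an integer. Let $\mathcal P=(P_K)$, indexed by subsets $K\subseteq X$ with $|K|\le k$, with $P_K\subseteq A^K$. For $L\subseteq X$ and $C\subseteq A^L$, $\mathcal P$ has the $k$-forth property for $C$ if for every $K\subseteq L$ with $|K|\le k$ and every $f\in P_K$ there is $g\in C$ with $g|_K=f$ and $g|_{K'}\in P_{K'}$ for every $K'\subseteq L$ with $|K'|\le k$. For $l\ge k$, $\mathcal P$ is a $(k,l)$-system from $X$ to $A$ if it has the $k$-forth property for $A^L$ for every $L\subseteq X$ with $|L|\le l$; it is non-trivial if no $P_K$ is empty. For structures $\mathcal X,\mathcal A$ of the same signature, a $(k,l)$-system from $X$ to $A$ is compatible with $\mathcal X$ if it additionally has the $k$-forth property for $\{g:L\to A\mid (g(y_1),\dots,g(y_n))\in R^{\mathrm{graph}(\mathcal A)}\}$ for every relation symbol $R$ of the graph signature and every $(y_1,\dots,y_n)\in R^{\mathrm{graph}(\mathcal X)}$, where $L=\{y_1,\dots,y_n\}$. $\mathcal A$ has relational width $(k,l)$ if every finite structure $\mathcal X$ of the same signature having a non-trivial compatible $(k,l)$-system admits a homomorphism to $\mathcal A$. $\mathcal A$ has bounded relational width if it has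 relational width $(k,l)$ for some $1\le k\le l$. -}

module Defs where

open import Data.Nat using (ℕ; suc; _≤_)
open import Data.Fin using (Fin; _≟_)
open import Data.Fin.Properties using (any?)
open import Data.Fin.Subset using (Subset; _∈_; _⊆_; ∣_∣)
open import Data.Vec using (Vec; lookup; tabulate; map; _∷ʳ_)
open import Data.Product using (Σ; Σ-syntax; _×_; _,_)
open import Data.Sum using (_⊎_; inj₁; inj₂)
open import Data.Unit using (⊤)
open import Relation.Nullary using (¬_; does)
open import Relation.Binary.PropositionalEquality using (_≡_)

record Signature : Set where
  field
    nOps  : ℕ
    opAr  : Fin nOps → ℕ
    nRels : ℕ
    relAr : Fin nRels → ℕ
open Signature public

record Structure (σ : Signature) (n : ℕ) : Set₁ where
  field
    op  : (i : Fin (nOps σ)) → Vec (Fin n) (opAr σ i) → Fin n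
    rel : (j : Fin (nRels σ)) → Vec (Fin n) (relAr σ j) → Set
open Structure public

IsHom : ∀ {σ m n} → Structure σ m → Structure σ n → (Fin m → Fin n) → Set
IsHom {σ} X A h =
  ((i : Fin (nOps σ)) (as : Vec _ (opAr σ i)) → h (op X i as) ≡ op A i (map h as))
  × ((j : Fin (nRels σ)) (as : Vec _ (relAr σ j)) → rel X j as → rel A j (map h as))

GRel : Signature → Set
GRel σ = Fin (nRels σ) ⊎ Fin (nOps σ)

grAr : (σ : Signature) → GRel σ → ℕ
grAr σ (inj₁ j) = relAr σ j
grAr σ (inj₂ i) = suc (opAr σ i)

graphRel : ∀ {σ n} → Structure σ n → (R : GRel σ) → Vec (Fin n) (grAr σ R) → Set
graphRel A (inj₁ j) v = rel A j v
graphRel A (inj₂ i) v = Σ[ as ∈ Vec _ _ ] v ≡ (as ∷ʳ op A i as)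

Dom : ∀ {m} → Subset m → Set
Dom {m} K = Σ[ x ∈ Fin m ] x ∈ K

Map : ∀ {m} → Subset m → ℕ → Set
Map K n = Dom K → Fin n

restrict : ∀ {m n} {K L : Subset m} → K ⊆ L → Map L n → Map K n
restrict sub g (x , p) = g (x , sub p)

_≗ₘ_ : ∀ {m n} {K : Subset m} → Map K n → Map K n → Set
f ≗ₘ g = ∀ d → f d ≡ g d

_∈ₘ_ : ∀ {m n} {K : Subset m} → Map K n → (Map K n → Set) → Set
g ∈ₘ C = Σ[ f ∈ _ ] C f × (f ≗ₘ g)

-- a family P = (P_K); only the entries with |K| ≤ k are ever used
Family : ℕ → ℕ → Set₁
Family m n = (K : Subset m) → Map K n → Set

Forth : ∀ {m n} → ℕ → Family m n → (L : Subset m) → (Map L n → Set) → Set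
Forth {m} {n} k P L C =
  (K : Subset m) (K⊆L : K ⊆ L) → ∣ K ∣ ≤ k → (f : Map K n) → P K f →
  Σ[ g ∈ Map L n ] C g × (restrict K⊆L g ≗ₘ f)
    × ((K' : Subset m) (K'⊆L : K' ⊆ L) → ∣ K' ∣ ≤ k → restrict K'⊆L g ∈ₘ P K')

IsSystem : ∀ {m n} → ℕ → ℕ → Family m n → Set
IsSystem {m} k l P = (L : Subset m) → ∣ L ∣ ≤ l → Forth k P L (λ _ → ⊤)

NonTrivial : ∀ {m n} → ℕ → Family m n → Set
NonTrivial {m} k P = (K : Subset m) → ∣ K ∣ ≤ k → Σ[ f ∈ _ ] P K f

setOf : ∀ {m r} → Vec (Fin m) r → Subset m
setOf ys = tabulate (λ x → does (any? (λ i → x ≟ lookup ys i)))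

TupleMaps : ∀ {σ m n} → Structure σ n → (R : GRel σ) →
            (ys : Vec (Fin m) (grAr σ R)) → Map (setOf ys) n → Set
TupleMaps A R ys g =
  Σ[ a ∈ Vec _ _ ] graphRel A R a
    × (∀ i (p : lookup ys i ∈ setOf ys) → g (lookup ys i , p) ≡ lookup a i)

Compatible : ∀ {σ m n} → Structure σ m → Structure σ n → ℕ → Family m n → Set
Compatible {σ} X A k P =
  (R : GRel σ) (ys : Vec _ (grAr σ R)) → graphRel X R ys →
  Forth k P (setOf ys) (TupleMaps A R ys)

HasRelWidth : ∀ {σ n} → ℕ → ℕ → Structure σ n → Set₁
HasRelWidth {σ} {n} k l A =
  (m : ℕ) (X : Structure σ m) (P : Family m n) →
  IsSystem k l P → NonTrivial k P → Compatible X A k P →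
  Σ[ h ∈ (Fin m → Fin n) ] IsHom X A h

HasBoundedRelWidth : ∀ {σ n} → Structure σ n → Set₁
HasBoundedRelWidth A = Σ[ k ∈ ℕ ] Σ[ l ∈ ℕ ] 1 ≤ k × k ≤ l × HasRelWidth k l A

{-# OPTIONS --safe #-}

-- The structure is the two-element Boolean algebra, given by the constant 1 and
-- the difference a ∧ ¬ b, together with the relation "a + b + c is odd".
--
-- Width (3,4): call e possible if some map in the system sends e to 1.  A local
-- solution on e, x, e ∧ ¬ x, e ∧ x with e ↦ 1 shows that one of e ∧ ¬ x, e ∧ x
-- is possible again, and it forces the value of x.  Starting from the constant 1
-- and running through all x yields a possible element forcing the value of every
-- x; these values form a homomorphism, since each constraint can be tested on its
-- scope together with that one element.
--
-- Failure of (2,3): take the free Boolean algebra on s, t, i.e. the power of the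
-- two-element one over four worlds, and declare (s, t, s + t) to be odd.  There
-- is no homomorphism, but the maps on at most two elements induced by the worlds
-- form a compatible system, because any two of s, t, s + t are independent.

module Submission where

open import Defs
open import Data.Bool using (if_then_else_)
open import Data.Fin using (Fin; zero; suc; #_; _≟_; finToFun; funToFin)
open import Data.Fin.Properties using (any?; all?; finToFun-funToFin)
open import Data.Fin.Subset using (Subset; _∈_; _∉_; _⊆_; ∣_∣; ⁅_⁆; _∪_; ⊥; inside; outside)
open import Data.Fin.Subset.Properties using (_∈?_; p⊆q⇒∣p∣≤∣q∣; x∈⁅x⁆; x∈p∪q⁺; ∪-identityˡ; ∣⊥∣≡0)
open import Data.List using (List; []; _∷_; allFin)
open import Data.List.Membership.Propositional.Properties using (∈-allFin)
open import Data.List.Relation.Unary.All as ListAll using ([]; _∷_)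
open import Data.Nat using (ℕ; suc; _≤_; z≤n; s≤s)
open import Data.Nat.Properties using (≤-refl; ≤-reflexive; ≤-trans; m≤n⇒m≤1+n)
open import Data.Product using (Σ-syntax; _×_; _,_; proj₁; proj₂)
open import Data.Sum using (inj₁; inj₂)
open import Data.Unit using (tt)
open import Data.Vec using (Vec; []; _∷_; _∷ʳ_; lookup; map)
open import Data.Vec.Properties using (lookup⇒[]=; []=⇒lookup; lookup∘tabulate; lookup-map; map-∷ʳ; ∷ʳ-injective)
open import Data.Vec.Properties.WithK using ([]=-irrelevant)
open import Data.Vec.Relation.Binary.Pointwise.Extensional using (ext; Pointwise-≡⇒≡)
open import Data.Vec.Relation.Unary.All using (All; []; _∷_)
open import Data.Vec.Relation.Unary.All.Properties using (lookup⁺)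
open import Function using (id; _∘_)
open import Relation.Binary.PropositionalEquality using (_≡_; _≢_; refl; sym; trans; cong; cong₂; subst)
open import Relation.Nullary using (¬_; yes; no; does; contradiction)
open import Relation.Nullary.Decidable using (dec-true; dec-false; toWitness; ¬?; _→-dec_; decidable-stable)

private
  variable
    m n r : ℕ
    σ : Signature

-- Scopes of tuples

∈-setOf⁺ : (ys : Vec (Fin m) r) (i : Fin r) → lookup ys i ∈ setOf ys
∈-setOf⁺ ys i = lookup⇒[]= _ (setOf ys)
  (trans (lookup∘tabulate _ (lookup ys i)) (dec-true (any? _) (i , refl)))

∈-setOf⁻ : (ys : Vec (Fin m) r) {x : Fin m} → x ∈ setOf ys → Σ[ i ∈ Fin r ] x ≡ lookup ys i
∈-setOf⁻ ys {x} p with any? (λ i → x ≟ lookup ys i) | trans (sym (lookup∘tabulate (λ z → does (any? (λ i → z ≟ lookup ys i))) x)) ([]=⇒lookup p)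
... | yes found | _ = found
... | no _      | ()

setOf-⊆ : {K : Subset m} {ys : Vec (Fin m) r} → All (_∈ K) ys → setOf ys ⊆ K
setOf-⊆ {ys = ys} ys∈K x∈ with ∈-setOf⁻ ys x∈
... | i , refl = lookup⁺ ys∈K i

∣⁅x⁆∪p∣≤1+∣p∣ : (x : Fin m) (p : Subset m) → ∣ ⁅ x ⁆ ∪ p ∣ ≤ suc ∣ p ∣
∣⁅x⁆∪p∣≤1+∣p∣ zero    (outside ∷ p) = s≤s (≤-reflexive (cong ∣_∣ (∪-identityˡ p)))
∣⁅x⁆∪p∣≤1+∣p∣ zero    (inside ∷ p)  = s≤s (m≤n⇒m≤1+n (≤-reflexive (cong ∣_∣ (∪-identityˡ p))))
∣⁅x⁆∪p∣≤1+∣p∣ (suc x) (outside ∷ p) = ∣⁅x⁆∪p∣≤1+∣p∣ x p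
∣⁅x⁆∪p∣≤1+∣p∣ (suc x) (inside ∷ p)  = s≤s (∣⁅x⁆∪p∣≤1+∣p∣ x p)

∣setOf∣≤ : (ys : Vec (Fin m) r) → ∣ setOf ys ∣ ≤ r
∣setOf∣≤ {m} []   = ≤-trans (p⊆q⇒∣p∣≤∣q∣ (setOf-⊆ {m} {K = ⊥} [])) (≤-reflexive (∣⊥∣≡0 m))
∣setOf∣≤ (y ∷ ys) = ≤-trans (p⊆q⇒∣p∣≤∣q∣ sub)
  (≤-trans (∣⁅x⁆∪p∣≤1+∣p∣ y (setOf ys)) (s≤s (∣setOf∣≤ ys)))
  where
  sub : setOf (y ∷ ys) ⊆ ⁅ y ⁆ ∪ setOf ys
  sub x∈ with ∈-setOf⁻ (y ∷ ys) x∈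
  ... | zero  , refl = x∈p∪q⁺ (inj₁ (x∈⁅x⁆ y))
  ... | suc i , refl = x∈p∪q⁺ (inj₂ (∈-setOf⁺ ys i))

lookup-ext : {A : Set} {xs ys : Vec A r} → (∀ i → lookup xs i ≡ lookup ys i) → xs ≡ ys
lookup-ext eq = Pointwise-≡⇒≡ (ext eq)

graphRel-op : (A : Structure σ n) {i : Fin (nOps σ)} {as : Vec (Fin n) (opAr σ i)} {b : Fin n} →
              graphRel A (inj₂ i) (as ∷ʳ b) → b ≡ op A i as
graphRel-op A {as = as} (as′ , eq) with ∷ʳ-injective as as′ eq
... | refl , b≡ = b≡

graphHom⇒hom : (X : Structure σ m) (A : Structure σ n) (h : Fin m → Fin n) →
               (∀ R ys → graphRel X R ys → graphRel A R (map h ys)) → IsHom X A h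
graphHom⇒hom X A h pres =
  (λ i as → graphRel-op A
    (subst (graphRel A (inj₂ i)) (map-∷ʳ h _ as) (pres (inj₂ i) _ (as , refl)))) ,
  (λ j → pres (inj₁ j))

-- Local solutions of a compatible system, as total assignments

module Local {A : Structure σ (suc n)} {X : Structure σ m} {k l : ℕ} {P : Family m (suc n)}
             (sys : IsSystem k l P) (comp : Compatible X A k P) where

  -- With total functions one assignment can be tested on many scopes without transporting
  -- membership proofs.
  Assignment : Set
  Assignment = Fin m → Fin (suc n)

  Admits : Subset m → Assignment → Set
  Admits K a = (a ∘ proj₁) ∈ₘ P K

  Solves : Subset m → Assignment → Set
  Solves L a = (K : Subset m) → K ⊆ L → ∣ K ∣ ≤ k → Admits K a

  total : {L : Subset m} → Map L (suc n) → Assignment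
  total {L} g x with x ∈? L
  ... | yes x∈L = g (x , x∈L)
  -- An arbitrary value off `L`; it exists because the target is `Fin (suc n)`.
  ... | no  _   = zero

  total-≡ : {L : Subset m} (g : Map L (suc n)) (x : Fin m) (x∈L : x ∈ L) → g (x , x∈L) ≡ total g x
  total-≡ {L} g x x∈L with x ∈? L
  ... | yes x∈L′ = cong (λ p → g (x , p)) ([]=-irrelevant x∈L x∈L′)
  ... | no  x∉L  = contradiction x∈L x∉L

  extend : {K L : Subset m} {a : Assignment} → K ⊆ L → ∣ K ∣ ≤ k → ∣ L ∣ ≤ l → Admits K a →
           Σ[ b ∈ Assignment ] Solves L b × (∀ {x} → x ∈ K → b x ≡ a x)
  extend {K} {L} K⊆L ∣K∣≤k ∣L∣≤l (f , Pf , f≗a)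
    with sys L ∣L∣≤l K K⊆L ∣K∣≤k f Pf
  ... | g , _ , g≗f , g∈P =
    total g
    , (λ K′ K′⊆L ∣K′∣≤k → let (f′ , Pf′ , f′≗g) = g∈P K′ K′⊆L ∣K′∣≤k in
         f′ , Pf′ , λ { (x , x∈K′) → trans (f′≗g (x , x∈K′)) (total-≡ g x (K′⊆L x∈K′)) })
    , λ {x} x∈K → trans (sym (total-≡ g x (K⊆L x∈K))) (trans (g≗f (x , x∈K)) (f≗a (x , x∈K)))

  -- As the scope has at most `k` elements, `a` restricted to it lies in `P`. The forth property
  -- from the scope to itself then yields a map in the relation that extends this restriction, hence
  -- equals it.
  satisfies : {L : Subset m} {a : Assignment} → Solves L a →
              (R : GRel σ) (ys : Vec (Fin m) (grAr σ R)) → graphRel X R ys →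
              ∣ setOf ys ∣ ≤ k → setOf ys ⊆ L → graphRel A R (map a ys)
  satisfies {a = a} sol R ys Rys ∣ys∣≤k ys⊆L
    with sol (setOf ys) ys⊆L ∣ys∣≤k
  ... | f , Pf , f≗a with comp R ys Rys (setOf ys) id ∣ys∣≤k f Pf
  ... | g , (t , Rt , g≡t) , g≗f , _ = subst (graphRel A R) (lookup-ext t≡) Rt
    where
    t≡ : ∀ i → lookup t i ≡ lookup (map a ys) i
    t≡ i = let p = ∈-setOf⁺ ys i in
      trans (sym (g≡t i p)) (trans (g≗f (_ , p)) (trans (f≗a (_ , p)) (sym (lookup-map i a ys))))

-- The two-element structure

pattern 𝟎 = zero
pattern 𝟏 = suc zero

_∖_ : Fin 2 → Fin 2 → Fin 2
𝟎 ∖ b = 𝟎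
𝟏 ∖ 𝟎 = 𝟏
𝟏 ∖ 𝟏 = 𝟎

_⊕_ : Fin 2 → Fin 2 → Fin 2
𝟎 ⊕ b = b
𝟏 ⊕ b = 𝟏 ∖ b

∖-𝟏 : ∀ {a b} → a ∖ b ≡ 𝟏 → a ≡ 𝟏 × b ≡ 𝟎
∖-𝟏 {𝟏} {𝟎} _ = refl , refl
∖-𝟏 {𝟏} {𝟏} ()

σ₂ : Signature
σ₂ = record
  { nOps  = 2
  ; opAr  = λ { zero → 0 ; (suc zero) → 2 }
  ; nRels = 1
  ; relAr = λ _ → 3
  }

pattern one  = zero
pattern diff = suc zero

grAr≤3 : (R : GRel σ₂) → grAr σ₂ R ≤ 3
grAr≤3 (inj₁ zero) = ≤-refl
grAr≤3 (inj₂ one)  = s≤s z≤n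
grAr≤3 (inj₂ diff) = ≤-refl

𝟐-op : (i : Fin 2) → Vec (Fin 2) (opAr σ₂ i) → Fin 2
𝟐-op one  []           = 𝟏
𝟐-op diff (a ∷ b ∷ []) = a ∖ b

Odd : Vec (Fin 2) 3 → Set
Odd (a ∷ b ∷ c ∷ []) = a ⊕ (b ⊕ c) ≡ 𝟏

𝟐 : Structure σ₂ 2
𝟐 = record { op = 𝟐-op ; rel = λ _ → Odd }

-- Relational width (3,4)

2≤3 : 2 ≤ 3
2≤3 = s≤s (s≤s z≤n)

3≤4 : 3 ≤ 4
3≤4 = s≤s 2≤3

module Width {m : ℕ} {X : Structure σ₂ m} {P : Family m 2}
             (sys : IsSystem 3 4 P) (nonTrivial : NonTrivial 3 P) (comp : Compatible X 𝟐 3 P) where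

  open Local sys comp

  _⊖_ : Fin m → Fin m → Fin m
  x ⊖ y = op X diff (x ∷ y ∷ [])

  ⊖-hom : {L : Subset m} {a : Assignment} → Solves L a → (x y : Fin m) →
          x ∈ L → y ∈ L → (x ⊖ y) ∈ L → a (x ⊖ y) ≡ a x ∖ a y
  ⊖-hom {a = a} sol x y x∈ y∈ xy∈ = graphRel-op 𝟐 {diff} {a x ∷ a y ∷ []}
    (satisfies sol (inj₂ diff) (x ∷ y ∷ (x ⊖ y) ∷ []) (x ∷ y ∷ [] , refl)
      (∣setOf∣≤ (x ∷ y ∷ (x ⊖ y) ∷ [])) (setOf-⊆ (x∈ ∷ y∈ ∷ xy∈ ∷ [])))

  Possible : Fin m → Set
  Possible e = Σ[ a ∈ Assignment ] Admits (setOf (e ∷ [])) a × a e ≡ 𝟏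

  -- Phrased on a scope of at most two elements, so that it applies in every local solution whose
  -- scope contains `e` and `x`.
  Forces : Fin m → Fin m → Fin 2 → Set
  Forces e x v = (a : Assignment) → Admits (setOf (e ∷ x ∷ [])) a → a e ≡ 𝟏 → a x ≡ v

  extendVec : ∀ {r s} (xs : Vec (Fin m) r) (ys : Vec (Fin m) s) {a : Assignment} → r ≤ 3 → s ≤ 4 →
              All (_∈ setOf ys) xs → Admits (setOf xs) a →
              Σ[ b ∈ Assignment ] Solves (setOf ys) b × (∀ i → b (lookup xs i) ≡ a (lookup xs i))
  extendVec xs ys r≤3 s≤4 xs⊆ys adm =
    let (b , sol , b≡a) = extend (setOf-⊆ xs⊆ys) (≤-trans (∣setOf∣≤ xs) r≤3)
                                 (≤-trans (∣setOf∣≤ ys) s≤4) adm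
    in b , sol , λ i → b≡a (∈-setOf⁺ xs i)

  admitsVec : ∀ {r} {L : Subset m} {a : Assignment} → Solves L a →
              (xs : Vec (Fin m) r) → r ≤ 3 → All (_∈ L) xs → Admits (setOf xs) a
  admitsVec sol xs r≤3 xs∈L = sol (setOf xs) (setOf-⊆ xs∈L) (≤-trans (∣setOf∣≤ xs) r≤3)

  Forces-trans : ∀ {e e′ x v} → Forces e′ e 𝟏 → Forces e x v → Forces e′ x v
  Forces-trans {e} {e′} {x} e′⇒e e⇒x a adm ae′≡𝟏 =
    let ys = e′ ∷ x ∷ e ∷ []
        e′∈ = ∈-setOf⁺ ys (# 0)
        x∈  = ∈-setOf⁺ ys (# 1)
        e∈  = ∈-setOf⁺ ys (# 2)
        (b , sol , b≡a) = extendVec (e′ ∷ x ∷ []) ys 2≤3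
                                    3≤4 (e′∈ ∷ x∈ ∷ []) adm
        be≡𝟏 = e′⇒e b (admitsVec sol (e′ ∷ e ∷ []) 2≤3 (e′∈ ∷ e∈ ∷ []))
                    (trans (b≡a (# 0)) ae′≡𝟏)
        bx≡v = e⇒x b (admitsVec sol (e ∷ x ∷ []) 2≤3 (e∈ ∷ x∈ ∷ [])) be≡𝟏
    in trans (sym (b≡a (# 1))) bx≡v

  -- A difference takes the value 1 only as `𝟏 ∖ 𝟎`; adding the third element to the scope makes its
  -- equation available.
  ⊖-Forces-minuend : ∀ e x → Forces (e ⊖ x) e 𝟏
  ⊖-Forces-minuend e x a adm ≡𝟏 =
    let ys = (e ⊖ x) ∷ e ∷ x ∷ []
        ∈ys = ∈-setOf⁺ ys
        (b , sol , b≡a) = extendVec ((e ⊖ x) ∷ e ∷ []) ys 2≤3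
                                    3≤4 (∈ys (# 0) ∷ ∈ys (# 1) ∷ []) adm
        hom = ⊖-hom sol e x (∈ys (# 1)) (∈ys (# 2)) (∈ys (# 0))
    in trans (sym (b≡a (# 1))) (proj₁ (∖-𝟏 (trans (sym hom) (trans (b≡a (# 0)) ≡𝟏))))

  ⊖-Forces-subtrahend : ∀ e x → Forces (e ⊖ x) x 𝟎
  ⊖-Forces-subtrahend e x a adm ≡𝟏 =
    let ys = (e ⊖ x) ∷ x ∷ e ∷ []
        ∈ys = ∈-setOf⁺ ys
        (b , sol , b≡a) = extendVec ((e ⊖ x) ∷ x ∷ []) ys 2≤3
                                    3≤4 (∈ys (# 0) ∷ ∈ys (# 1) ∷ []) adm
        hom = ⊖-hom sol e x (∈ys (# 2)) (∈ys (# 1)) (∈ys (# 0))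
    in trans (sym (b≡a (# 1))) (proj₂ (∖-𝟏 (trans (sym hom) (trans (b≡a (# 0)) ≡𝟏))))

  -- e ⊖ (e ⊖ x) plays the role of the meet of e and x.
  meet-Forces : ∀ e x → Forces (e ⊖ (e ⊖ x)) x 𝟏
  meet-Forces e x a adm ≡𝟏 =
    let y = e ⊖ x
        z = e ⊖ y
        -- The equations of both differences must hold in one local solution, which takes four
        -- elements.
        ys = z ∷ x ∷ e ∷ y ∷ []
        ∈ys = ∈-setOf⁺ ys
        (b , sol , b≡a) = extendVec (z ∷ x ∷ []) ys 2≤3 ≤-refl
                                    (∈ys (# 0) ∷ ∈ys (# 1) ∷ []) adm
        y-hom = ⊖-hom sol e x (∈ys (# 2)) (∈ys (# 1)) (∈ys (# 3))
        z-hom = ⊖-hom sol e y (∈ys (# 2)) (∈ys (# 3)) (∈ys (# 0))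
        (be≡𝟏 , by≡𝟎) = ∖-𝟏 (trans (sym z-hom) (trans (b≡a (# 0)) ≡𝟏))
    in trans (sym (b≡a (# 1))) (cancel be≡𝟏 (trans (sym y-hom) by≡𝟎))
    where
    cancel : ∀ {a b} → a ≡ 𝟏 → a ∖ b ≡ 𝟎 → b ≡ 𝟏
    cancel {b = 𝟏} refl refl = refl

  -- The local solution `b` has `b e ≡ 𝟏`, so it sends `y` to 1 if `b x` is 0 and `z` to 1
  -- otherwise; `b` itself witnesses that the chosen element is possible.
  refine : ∀ e x → Possible e →
           Σ[ e′ ∈ Fin m ] Possible e′ × Forces e′ e 𝟏 × Σ[ v ∈ Fin 2 ] Forces e′ x v
  refine e x (a , adm , ae≡𝟏) = split (b x) refl
    where
    y = e ⊖ x
    z = e ⊖ y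
    ys = e ∷ x ∷ y ∷ z ∷ []
    ∈ys = ∈-setOf⁺ ys
    extension = extendVec (e ∷ []) ys (s≤s z≤n) ≤-refl (∈ys (# 0) ∷ []) adm
    b = proj₁ extension
    sol = proj₁ (proj₂ extension)
    be≡𝟏 : b e ≡ 𝟏
    be≡𝟏 = trans (proj₂ (proj₂ extension) (# 0)) ae≡𝟏
    y-hom = ⊖-hom sol e x (∈ys (# 0)) (∈ys (# 1)) (∈ys (# 2))
    z-hom = ⊖-hom sol e y (∈ys (# 0)) (∈ys (# 2)) (∈ys (# 3))
    split : (v : Fin 2) → b x ≡ v →
            Σ[ e′ ∈ Fin m ] Possible e′ × Forces e′ e 𝟏 × Σ[ v ∈ Fin 2 ] Forces e′ x v
    split 𝟎 bx≡𝟎 =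
      y , (b , admitsVec sol (y ∷ []) (s≤s z≤n) (∈ys (# 2) ∷ []) , trans y-hom (cong₂ _∖_ be≡𝟏 bx≡𝟎))
        , ⊖-Forces-minuend e x , 𝟎 , ⊖-Forces-subtrahend e x
    split 𝟏 bx≡𝟏 =
      z , (b , admitsVec sol (z ∷ []) (s≤s z≤n) (∈ys (# 3) ∷ []) ,
           trans z-hom (cong₂ _∖_ be≡𝟏 (trans y-hom (cong₂ _∖_ be≡𝟏 bx≡𝟏))))
        , ⊖-Forces-minuend e y , 𝟏 , meet-Forces e x

  -- Each new element forces the previous one to be 1, so by transitivity the values forced earlier
  -- persist.
  refineAll : (xs : List (Fin m)) → ∀ e → Possible e →
              Σ[ e′ ∈ Fin m ] Possible e′ × Forces e′ e 𝟏
                × ListAll.All (λ x → Σ[ v ∈ Fin 2 ] Forces e′ x v) xs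
  refineAll []       e pe = e , pe , (λ _ _ → id) , []
  refineAll (x ∷ xs) e pe =
    let (e₁ , pe₁ , e₁⇒e , v , e₁⇒x) = refine e x pe
        (e₂ , pe₂ , e₂⇒e₁ , e₂⇒xs)   = refineAll xs e₁ pe₁
    in e₂ , pe₂ , Forces-trans e₂⇒e₁ e₁⇒e , (v , Forces-trans e₂⇒e₁ e₁⇒x) ∷ e₂⇒xs

  one-Possible : Possible (op X one [])
  one-Possible =
    let c = op X one []
        ∣c∣≤3 = ≤-trans (∣setOf∣≤ (c ∷ [])) (s≤s z≤n)
        (f , Pf) = nonTrivial (setOf (c ∷ [])) ∣c∣≤3
        (b , sol , _) = extend id ∣c∣≤3 (≤-trans (∣setOf∣≤ (c ∷ [])) (s≤s z≤n))
                               (f , Pf , λ { (x , x∈) → total-≡ f x x∈ })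
    in b , sol (setOf (c ∷ [])) id ∣c∣≤3 ,
       graphRel-op 𝟐 {one} {[]} (satisfies sol (inj₂ one) (c ∷ []) ([] , refl) ∣c∣≤3 id)

  hom : Σ[ h ∈ (Fin m → Fin 2) ] IsHom X 𝟐 h
  hom = h , graphHom⇒hom X 𝟐 h preserves
    where
    refined = refineAll (allFin m) _ one-Possible
    e = proj₁ refined
    e-Possible = proj₁ (proj₂ refined)
    forced : ∀ x → Σ[ v ∈ Fin 2 ] Forces e x v
    forced x = ListAll.lookup (proj₂ (proj₂ (proj₂ refined))) (∈-allFin x)
    h : Fin m → Fin 2
    h = proj₁ ∘ forced
    preserves : ∀ R ys → graphRel X R ys → graphRel 𝟐 R (map h ys)
    preserves R ys Rys =
      let (a , adm , ae≡𝟏) = e-Possible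
          ∈zs = ∈-setOf⁺ (e ∷ ys)
          ys⊆zs = λ {x} (x∈ : x ∈ setOf ys) → let (i , x≡) = ∈-setOf⁻ ys x∈ in
                    subst (_∈ setOf (e ∷ ys)) (sym x≡) (∈zs (suc i))
          -- The scope of a tuple together with `e` has at most 3 + 1 elements. Since `b e ≡ 𝟏`,
          -- forcing makes `b` agree with `h` on the tuple.
          (b , sol , b≡a) = extendVec (e ∷ []) (e ∷ ys) (s≤s z≤n) (s≤s (grAr≤3 R)) (∈zs zero ∷ []) adm
          b≡h = λ i → proj₂ (forced (lookup ys i)) b
                        (admitsVec sol (e ∷ lookup ys i ∷ []) 2≤3
                                   (∈zs zero ∷ ∈zs (suc i) ∷ []))
                        (trans (b≡a zero) ae≡𝟏)
          map-b≡map-h = lookup-ext λ i →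
            trans (lookup-map i b ys) (trans (b≡h i) (sym (lookup-map i h ys)))
      in subst (graphRel 𝟐 R) map-b≡map-h
           (satisfies sol R ys Rys (≤-trans (∣setOf∣≤ ys) (grAr≤3 R)) ys⊆zs)

-- Failure of relational width (2,3)

World : Set
World = Fin 4

-- The 16 elements code the functions from the four worlds to `Fin 2`; `eval w` is the projection to
-- the coordinate `w`.
eval : World → Fin 16 → Fin 2
eval w x = finToFun {2} {4} x w

row : Vec (Fin 2) 4 → Fin 16
row = funToFin ∘ lookup

-- Rows are elements of the power, columns are worlds: the columns are exactly the
-- triples of even sum, so the third row is the sum of the first two.
T : Vec (Fin 16) 3
T = row (𝟎 ∷ 𝟎 ∷ 𝟏 ∷ 𝟏 ∷ [])
  ∷ row (𝟎 ∷ 𝟏 ∷ 𝟎 ∷ 𝟏 ∷ [])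
  ∷ row (𝟎 ∷ 𝟏 ∷ 𝟏 ∷ 𝟎 ∷ [])
  ∷ []

𝕏 : Structure σ₂ 16
𝕏 = record
  { op  = λ i as → funToFin (λ w → op 𝟐 i (map (eval w) as))
  ; rel = λ _ v → v ≡ T
  }

-- The join of the two differences, written by De Morgan as a term in the operations, so that
-- homomorphisms preserve it.
symDiff : Structure σ₂ n → Fin n → Fin n → Fin n
symDiff A x y = compl (compl (x - y) - (y - x))
  where
  _-_ : _ → _ → _
  a - b = op A diff (a ∷ b ∷ [])
  compl : _ → _
  compl a = op A one [] - a

symDiff-hom : (X : Structure σ₂ m) (A : Structure σ₂ n) {h : Fin m → Fin n} → IsHom X A h →
              ∀ x y → h (symDiff X x y) ≡ symDiff A (h x) (h y)
symDiff-hom X A {h} (h-op , _) x y = minus h-one (minus (minus h-one (minus refl refl)) (minus refl refl))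
  where
  minus : ∀ {x y a b} → h x ≡ a → h y ≡ b → h (op X diff (x ∷ y ∷ [])) ≡ op A diff (a ∷ b ∷ [])
  minus refl refl = h-op diff _
  h-one : h (op X one []) ≡ op A one []
  h-one = h-op one []

symDiff-even : ∀ a b → ¬ Odd (a ∷ b ∷ symDiff 𝟐 a b ∷ [])
symDiff-even 𝟎 𝟎 ()
symDiff-even 𝟎 𝟏 ()
symDiff-even 𝟏 𝟎 ()
symDiff-even 𝟏 𝟏 ()

no-hom : ∀ h → ¬ IsHom 𝕏 𝟐 h
no-hom h h-hom = symDiff-even (h x) (h y)
  -- The third entry of `T` evaluates to `symDiff 𝕏 x y`.
  (subst (λ c → Odd (h x ∷ h y ∷ c ∷ [])) (symDiff-hom 𝕏 𝟐 h-hom x y) (proj₂ h-hom zero T refl))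
  where
  x = lookup T (# 0)
  y = lookup T (# 1)

Q : Family 16 2
Q K f = Σ[ w ∈ World ] ∀ d → f d ≡ eval w (proj₁ d)

Q-system : IsSystem 2 3 Q
Q-system L _ K K⊆L _ f (w , f≡) =
  eval w ∘ proj₁ , tt , (λ d → sym (f≡ d)) , λ K′ _ _ → eval w ∘ proj₁ , (w , λ _ → refl) , λ _ → refl

Q-nonTrivial : NonTrivial 2 Q
Q-nonTrivial K _ = eval zero ∘ proj₁ , zero , λ _ → refl

-- Complementing the value at one entry of `T` makes the even triple of the world `w` odd and leaves
-- all other elements as they are in `w`.
twist : World → Fin 3 → Fin 16 → Fin 2
twist w u x = if does (x ≟ lookup T u) then 𝟏 ∖ eval w x else eval w x

twist-away : ∀ w u {x} → x ≢ lookup T u → twist w u x ≡ eval w x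
twist-away w u {x} x≢ = cong (if_then 𝟏 ∖ eval w x else eval w x) (dec-false (x ≟ lookup T u) x≢)

twist-odd : ∀ w u → Odd (map (twist w u) T)
twist-odd = toWitness {a? = all? λ w → all? λ u → _ ≟ _} tt

-- Flipping two coordinates of an even triple gives an even triple, i.e. a world.
twist-local : ∀ w u v → Σ[ w′ ∈ World ] ∀ i → i ≢ v → twist w u (lookup T i) ≡ eval w′ (lookup T i)
twist-local = toWitness {a? = all? λ w → all? λ u → all? λ v → any? λ w′ → all? λ i →
  ¬? (i ≟ v) →-dec (twist w u (lookup T i) ≟ eval w′ (lookup T i))} tt

missed : (K : Subset 16) → ∣ K ∣ ≤ 2 → Σ[ u ∈ Fin 3 ] lookup T u ∉ K
missed K ∣K∣≤2 with any? (λ u → ¬? (lookup T u ∈? K))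
... | yes found = found
-- The entries of `T` are distinct, so `∣ setOf T ∣` evaluates to 3.
... | no  none  = contradiction (≤-trans (p⊆q⇒∣p∣≤∣q∣ T⊆K) ∣K∣≤2) λ { (s≤s (s≤s ())) }
  where
  T⊆K : setOf T ⊆ K
  T⊆K x∈ with ∈-setOf⁻ T x∈
  ... | i , refl = decidable-stable (lookup T i ∈? K) (λ i∉ → none (i , i∉))

Q-compatible : Compatible 𝕏 𝟐 2 Q
Q-compatible (inj₁ zero) .T refl K K⊆T ∣K∣≤2 f (w , f≡) =
  -- Flipping at an entry outside `K` gives an odd triple that still agrees with `f` on `K`.
  let (u , u∉K) = missed K ∣K∣≤2 in
  twist w u ∘ proj₁
  , (map (twist w u) T , twist-odd w u , λ i _ → sym (lookup-map i (twist w u) T))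
  , (λ { (x , x∈K) → trans (twist-away w u (λ { refl → u∉K x∈K })) (sym (f≡ (x , x∈K))) })
  , λ K′ K′⊆T ∣K′∣≤2 →
      -- A second flip, at an entry outside `K′`, restores even sum: the resulting world `w′`
      -- induces the same map on `K′`.
      let (v , v∉K′) = missed K′ ∣K′∣≤2
          (w′ , agree) = twist-local w u v
      in eval w′ ∘ proj₁ , (w′ , λ _ → refl)
       , λ { (x , x∈K′) → let (i , x≡) = ∈-setOf⁻ T (K′⊆T x∈K′) in
               trans (cong (eval w′) x≡)
                 (trans (sym (agree i λ i≡v → v∉K′ (subst (_∈ K′) (trans x≡ (cong (lookup T) i≡v)) x∈K′)))
                        (cong (twist w u) (sym x≡))) }
-- The operations of `𝕏` are pointwise, so the projection to `w` respects their graphs on any scope.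
Q-compatible (inj₂ i) ys (as , refl) K K⊆ys ∣K∣≤2 f (w , f≡) =
  eval w ∘ proj₁
  , (map (eval w) ys , (map (eval w) as , eval-graph) , λ j _ → sym (lookup-map j (eval w) ys))
  , (λ d → sym (f≡ d))
  , λ K′ _ _ → eval w ∘ proj₁ , (w , λ _ → refl) , λ _ → refl
  where
  eval-graph : map (eval w) (as ∷ʳ op 𝕏 i as) ≡ map (eval w) as ∷ʳ op 𝟐 i (map (eval w) as)
  eval-graph = trans (map-∷ʳ (eval w) _ as)
    (cong (map (eval w) as ∷ʳ_) (finToFun-funToFin (λ w′ → op 𝟐 i (map (eval w′) as)) w))

theorem5 : Σ[ σ ∈ Signature ] Σ[ n ∈ ℕ ] Σ[ A ∈ Structure σ n ]
    (HasBoundedRelWidth A × ¬ HasRelWidth 2 3 A)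
theorem5 = σ₂ , 2 , 𝟐
  , (3 , 4 , s≤s z≤n , 3≤4 , λ m X P sys nonTrivial comp → Width.hom sys nonTrivial comp)
  , λ width → let (h , h-hom) = width 16 𝕏 Q Q-system Q-nonTrivial Q-compatible in no-hom h h-hom
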